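{- Let $\lambda>0$ and $\mu$ be real numbers. Let $\mathsf{Paw}$ be the graph on $4$ vertices obtained from the triangle $K_3$ by appending a leaf to one of its vertices. The multiset $\{0, \lambda,\lambda, \mu\}$ is Laplacian realizable for $\mathsf{Paw}$ if and only if $\mu \geq (2 + \sqrt{3})\lambda$ or $0 < \mu \leq (2 - \sqrt{3})\lambda$.
   Context: For a finite simple graph $G$ on $n$ vertices, $\mathcal{S}_L(G)$ denotes the set of $n\times n$ real symmetric matrices $A=[a_{i,j}]$ such that $a_{i,j}<0$ if $\{i,j\}\in E(G)$, $a_{i,j}=0$ if $i\neq j$ and $\{i,j\}\notin E(G)$, and $a_{i,i}=-\sum_{k\neq i}a_{i,k}$ for all $i$. A multiset of $n$ real numbers is Laplacian realizable for $G$ if it is the spectrum (multiset of eigenvalues) of some $A\in\mathcal{S}_L(G)$. -}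

module Defs where

open import Level using (Level; _⊔_; 0ℓ) renaming (suc to lsuc)
open import Algebra.Apartness.Bundles using (HeytingField)
open import Algebra.Apartness.Structures using (IsHeytingField)
import Algebra.Apartness.Properties.HeytingCommutativeRing as HCRProperties
open import Algebra.Bundles using (CommutativeRing)
import Algebra.Properties.Monoid.Sum as MonoidSum
import Algebra.Properties.Ring as RingProperties
import Algebra.Solver.Ring.NaturalCoefficients.Default as SemiringSolver
open import Data.Empty using (⊥)
open import Data.Fin.Base using (Fin; zero; suc; punchIn)
open import Data.Fin.Properties using (_≟_)
open import Data.Nat.Base using (ℕ; zero; suc)
open import Data.Product.Base using (Σ; ∃-syntax; _×_; _,_; proj₁; proj₂)
open import Data.Sum.Base using (_⊎_; inj₁; inj₂; [_,_]′)
open import Data.Vec.Functional using (Vector)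
open import Data.Bool.Base using (if_then_else_)
open import Relation.Binary.Core using (Rel)
open import Relation.Binary.Definitions using (Decidable; Irreflexive; Symmetric)
open import Relation.Binary.PropositionalEquality.Core as ≡ using (_≡_; _≢_)
open import Relation.Binary.Structures using (IsStrictPartialOrder)
import Relation.Binary.Reasoning.Setoid as ≈-Reasoning
open import Relation.Nullary.Decidable.Core using (does; no; ¬?)
open import Relation.Nullary.Negation.Core using (¬_; contradiction)
open import Relation.Unary using (Pred; _∈_)

-- The real numbers, axiomatised as an ordered field in which every
-- inhabited, bounded-above, located set has a supremum.  Apartness is
-- derived from the strict order, so `isHeytingField` says in particular that
-- x is invertible iff x < 0 or 0 < x, and that x ≈ y iff neither x < y nor
-- y < x.  Locatedness makes the axiom hold for the constructive (Cauchy
-- or Dedekind) reals; classically every set is located, so classically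
-- these are precisely the axioms of a Dedekind-complete ordered field, which
-- determine ℝ up to isomorphism.
record Reals (c ℓ : Level) : Set (lsuc (c ⊔ ℓ)) where
  infix  8 -_
  infixl 7 _*_
  infixl 6 _+_
  infix  4 _≈_ _<_ _≤_ _#_
  field
    Carrier : Set c
    _≈_ _<_ : Rel Carrier ℓ
    _+_ _*_ : Carrier → Carrier → Carrier
    -_      : Carrier → Carrier
    0# 1#   : Carrier

  _#_ : Rel Carrier ℓ
  x # y = x < y ⊎ y < x

  _≤_ : Rel Carrier ℓ
  x ≤ y = ¬ (y < x)

  field
    isHeytingField       : IsHeytingField _≈_ _#_ _+_ _*_ -_ 0# 1#
    isStrictPartialOrder : IsStrictPartialOrder _≈_ _<_
    +-monoˡ-<            : ∀ z {x y} → x < y → x + z < y + z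
    *-pos                : ∀ {x y} → 0# < x → 0# < y → 0# < x * y

  IsUpperBound : Pred Carrier ℓ → Carrier → Set (c ⊔ ℓ)
  IsUpperBound S u = ∀ x → x ∈ S → x ≤ u

  _ExceededIn_ : Carrier → Pred Carrier ℓ → Set (c ⊔ ℓ)
  y ExceededIn S = ∃[ x ] x ∈ S × y < x

  IsSupremum : Pred Carrier ℓ → Carrier → Set (c ⊔ ℓ)
  IsSupremum S s = IsUpperBound S s × (∀ {y} → y < s → y ExceededIn S)

  Located : Pred Carrier ℓ → Set (c ⊔ ℓ)
  Located S = ∀ {p q} → p < q → p ExceededIn S ⊎ IsUpperBound S q

  field
    complete : ∀ S → ∃[ x ] x ∈ S → ∃[ u ] IsUpperBound S u → Located S →
               ∃[ s ] IsSupremum S s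

  open IsHeytingField isHeytingField public
  open IsStrictPartialOrder isStrictPartialOrder public
    using (<-respʳ-≈; <-respˡ-≈)
    renaming (irrefl to <-irrefl; trans to <-trans; asym to <-asym)

  heytingField : HeytingField c ℓ ℓ
  heytingField = record { isHeytingField = isHeytingField }

  open HeytingField heytingField public using (heytingCommutativeRing)

  commutativeRing : CommutativeRing c ℓ
  commutativeRing = record { isCommutativeRing = isCommutativeRing }

  2# 3# : Carrier
  2# = 1# + 1#
  3# = 2# + 1#

module SquareRoot {c ℓ} (ℝ : Reals c ℓ) where
  open Reals ℝ
  open CommutativeRing commutativeRing using (ring; commutativeSemiring)
  open RingProperties ring using (-‿involutive; -‿distribˡ-*; -‿distribʳ-*)
  open SemiringSolver commutativeSemiring using (solve; _:=_; _:+_; _:*_; con)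
  open HCRProperties heytingCommutativeRing using (1#0; x-0≈x; invertibleˡ⇒#)

  <-cotrans : ∀ {x y} → x < y → ∀ z → x < z ⊎ z < y
  <-cotrans x<y z with #-cotrans (inj₁ x<y) z
  ... | inj₁ (inj₁ x<z) = inj₁ x<z
  ... | inj₁ (inj₂ z<x) = inj₂ (<-trans z<x x<y)
  ... | inj₂ (inj₁ z<y) = inj₂ z<y
  ... | inj₂ (inj₂ y<z) = inj₁ (<-trans x<y y<z)

  <-≤-trans : ∀ {x y z} → x < y → y ≤ z → x < z
  <-≤-trans {z = z} x<y y≤z with <-cotrans x<y z
  ... | inj₁ x<z = x<z
  ... | inj₂ z<y = contradiction z<y y≤z

  ≤-<-trans : ∀ {x y z} → x ≤ y → y < z → x < z
  ≤-<-trans {x = x} x≤y y<z with <-cotrans y<z x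
  ... | inj₁ y<x = contradiction y<x x≤y
  ... | inj₂ x<z = x<z

  +-monoʳ-< : ∀ z {x y} → x < y → z + x < z + y
  +-monoʳ-< z x<y = <-respˡ-≈ (+-comm _ z) (<-respʳ-≈ (+-comm _ z) (+-monoˡ-< z x<y))

  +-pos : ∀ {x y} → 0# < x → 0# < y → 0# < x + y
  +-pos {x} 0<x 0<y =
    <-trans 0<x (<-respˡ-≈ (+-identityʳ x) (+-monoʳ-< x 0<y))

  +-nonneg-pos : ∀ {x y} → 0# ≤ x → 0# < y → 0# < x + y
  +-nonneg-pos {x} 0≤x 0<y =
    ≤-<-trans 0≤x (<-respˡ-≈ (+-identityʳ x) (+-monoʳ-< x 0<y))

  x+d : ∀ {x y d} → 0# < d → x + d ≈ y → x < y
  x+d {x} 0<d eq = <-respˡ-≈ (+-identityʳ x) (<-respʳ-≈ eq (+-monoʳ-< x 0<d))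

  -- The existence lemmas are opaque because `with` normalises the proofs they
  -- return, which is prohibitively slow.
  opaque
    diff : ∀ {x y} → x < y → ∃[ d ] 0# < d × x + d ≈ y
    diff {x} {y} x<y = y - x
      , <-respˡ-≈ (-‿inverseʳ x) (+-monoˡ-< (- x) x<y)
      , (begin
          x + (y + - x)  ≈⟨ +-congˡ (+-comm y (- x)) ⟩
          x + (- x + y)  ≈⟨ +-assoc x (- x) y ⟨
          x + - x + y    ≈⟨ +-congʳ (-‿inverseʳ x) ⟩
          0# + y         ≈⟨ +-identityˡ y ⟩
          y              ∎)
      where open ≈-Reasoning setoid

  *-monoʳ-< : ∀ {z x y} → 0# < z → x < y → z * x < z * y
  *-monoʳ-< {z} {x} 0<z x<y with diff x<y
  ... | d , 0<d , eq = x+d (*-pos 0<z 0<d) (trans (sym (distribˡ z x d)) (*-congˡ eq))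

  neg-pos : ∀ {x} → x < 0# → 0# < - x
  neg-pos {x} x<0 =
    <-respˡ-≈ (-‿inverseʳ x) (<-respʳ-≈ (+-identityˡ (- x)) (+-monoˡ-< (- x) x<0))

  neg²-pos : ∀ {x} → x < 0# → 0# < x * x
  neg²-pos {x} x<0 = <-respʳ-≈ eq (*-pos (neg-pos x<0) (neg-pos x<0))
    where
    eq : - x * - x ≈ x * x
    eq = trans (sym (-‿distribˡ-* x (- x)))
           (trans (-‿cong (sym (-‿distribʳ-* x x))) (-‿involutive (x * x)))

  0<1 : 0# < 1#
  0<1 with 1#0
  ... | inj₁ 1<0 = <-respʳ-≈ (*-identityˡ 1#) (neg²-pos 1<0)
  ... | inj₂ 0<1 = 0<1

  0<2 : 0# < 2#
  0<2 = +-pos 0<1 0<1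

  0<3 : 0# < 3#
  0<3 = +-pos 0<2 0<1

  opaque
    pos-inverse : ∀ {x} → 0# < x → ∃[ y ] 0# < y × x * y ≈ 1#
    pos-inverse {x} 0<x with #⇒invertible (inj₂ 0<x)
    ... | y , _ , xy≈1 = y , 0<y , eq
      where
      eq : x * y ≈ 1#
      eq = trans (*-congʳ (sym (x-0≈x x))) xy≈1
      0<y : 0# < y
      0<y with invertibleˡ⇒# {y} {0#} (x , trans (*-congˡ (x-0≈x y)) eq)
      ... | inj₂ 0<y = 0<y
      ... | inj₁ y<0 = contradiction 0<1
        (<-asym (<-respˡ-≈ eq (<-respʳ-≈ (zeroʳ x) (*-monoʳ-< 0<x y<0))))

  opaque
    between : ∀ {x y} → x < y → ∃[ m ] x < m × m < y
    between {x} {y} x<y with diff x<y | pos-inverse 0<2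
    ... | d , 0<d , eq | h , 0<h , 2h≈1 =
      x + h * d , x+d (*-pos 0<h 0<d) refl , x+d (*-pos 0<h 0<d) (begin
        x + h * d + h * d  ≈⟨ solve 3 (λ x h d → x :+ h :* d :+ h :* d
                                 := x :+ (con 1 :+ con 1) :* h :* d) refl x h d ⟩
        x + 2# * h * d     ≈⟨ +-congˡ (*-congʳ 2h≈1) ⟩
        x + 1# * d         ≈⟨ +-congˡ (*-identityˡ d) ⟩
        x + d              ≈⟨ eq ⟩
        y                  ∎)
      where open ≈-Reasoning setoid

  *-nonneg-pos : ∀ {x y} → 0# ≤ x → 0# < y → 0# ≤ x * y
  *-nonneg-pos {x} {y} 0≤x 0<y xy<0 with pos-inverse 0<y
  ... | v , 0<v , yv≈1 = 0≤x (<-respˡ-≈ eq (<-respʳ-≈ (zeroʳ v) (*-monoʳ-< 0<v xy<0)))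
    where
    open ≈-Reasoning setoid
    eq : v * (x * y) ≈ x
    eq = begin
      v * (x * y)  ≈⟨ solve 3 (λ v x y → v :* (x :* y) := x :* (y :* v)) refl v x y ⟩
      x * (y * v)  ≈⟨ *-congˡ yv≈1 ⟩
      x * 1#       ≈⟨ *-identityʳ x ⟩
      x            ∎

  +-cancel-< : ∀ {x y z} → x + z < y + z → x < y
  +-cancel-< {x} {y} {z} x+z<y+z =
    <-respˡ-≈ (eq x) (<-respʳ-≈ (eq y) (+-monoˡ-< (- z) x+z<y+z))
    where
    eq : ∀ w → w + z + - z ≈ w
    eq w = trans (+-assoc w z (- z)) (trans (+-congˡ (-‿inverseʳ z)) (+-identityʳ w))

  -- |p| < q implies p² < q²
  square-mono : ∀ {p q} → p < q → - q < p → p * p < q * q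
  square-mono {p} {q} p<q -q<p with diff p<q
  ... | d , 0<d , eq = x+d (*-pos 0<d 0<q+p) (begin
      p * p + d * (q + p)    ≈⟨ solve 3 (λ p q d → p :* p :+ d :* (q :+ p)
                                   := (p :+ d) :* p :+ d :* q) refl p q d ⟩
      (p + d) * p + d * q    ≈⟨ +-congʳ (*-congʳ eq) ⟩
      q * p + d * q          ≈⟨ solve 3 (λ p q d → q :* p :+ d :* q
                                   := (p :+ d) :* q) refl p q d ⟩
      (p + d) * q            ≈⟨ *-congʳ eq ⟩
      q * q                  ∎)
    where
    open ≈-Reasoning setoid
    0<q+p : 0# < q + p
    0<q+p = <-respˡ-≈ (-‿inverseʳ q) (+-monoʳ-< q -q<p)

  neg-neg : ∀ {x} → 0# < x → - x < 0#
  neg-neg {x} 0<x =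
    <-respˡ-≈ (+-identityˡ (- x)) (<-respʳ-≈ (-‿inverseʳ x) (+-monoˡ-< (- x) 0<x))

  square-mono⁺ : ∀ {p q} → 0# ≤ p → p < q → p * p < q * q
  square-mono⁺ 0≤p p<q =
    square-mono p<q (<-≤-trans (neg-neg (≤-<-trans 0≤p p<q)) 0≤p)

  opaque
    small : ∀ {s d} → 0# ≤ s → 0# < d →
            ∃[ e ] 0# < e × e < 1# × e * (s + s + 1#) < d
    small {s} {d} 0≤s 0<d with pos-inverse {s + s + 1# + d} (+-pos 0<k 0<d)
      where
      0<k : 0# < s + s + 1#
      0<k = <-respʳ-≈ (sym (+-assoc s s 1#)) (+-nonneg-pos 0≤s (+-nonneg-pos 0≤s 0<1))
    ... | u , 0<u , ku≈1 = e , 0<e , e<1 , x+d (*-pos 0<e 0<d) (begin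
        e * (s + s + 1#) + e * d
          ≈⟨ distribˡ e (s + s + 1#) d ⟨
        d * u * (s + s + 1# + d)
          ≈⟨ *-assoc d u _ ⟩
        d * (u * (s + s + 1# + d))
          ≈⟨ *-congˡ (trans (*-comm u _) ku≈1) ⟩
        d * 1#
          ≈⟨ *-identityʳ d ⟩
        d ∎)
      where
      open ≈-Reasoning setoid
      e : Carrier
      e = d * u
      0<e : 0# < e
      0<e = *-pos 0<d 0<u
      0<k : 0# < s + s + 1#
      0<k = <-respʳ-≈ (sym (+-assoc s s 1#)) (+-nonneg-pos 0≤s (+-nonneg-pos 0≤s 0<1))
      e<1 : e < 1#
      e<1 = x+d (*-pos 0<u 0<k) (trans
        (solve 3 (λ d u k → d :* u :+ u :* k := (k :+ d) :* u) refl d u (s + s + 1#))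
        ku≈1)

  module _ {a} (0≤a : 0# ≤ a) where

    Below : Pred Carrier ℓ
    Below x = x < 0# ⊎ x * x < a

    bounded : ∀ {q} → 0# < q → a < q * q → IsUpperBound Below q
    bounded 0<q a<q² x (inj₁ x<0)  q<x = <-asym x<0 (<-trans 0<q q<x)
    bounded 0<q a<q² x (inj₂ x²<a) q<x =
      <-asym (<-trans x²<a a<q²) (square-mono⁺ (<-asym 0<q) q<x)

    below-or-bound : ∀ {m q} → m < q → m ∈ Below ⊎ IsUpperBound Below q
    below-or-bound {m} {q} m<q = [ (λ m<0 → inj₁ (inj₁ m<0)) , positive ]′ (<-cotrans m<q 0#)
      where
      module _ (0<q : 0# < q) where
        large : - q < m → m ∈ Below ⊎ IsUpperBound Below q
        large -q<m = [ (λ m²<a → inj₁ (inj₂ m²<a)) , (λ a<q² → inj₂ (bounded 0<q a<q²)) ]′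
                       (<-cotrans (square-mono m<q -q<m) a)

        positive : m ∈ Below ⊎ IsUpperBound Below q
        positive = [ large , (λ m<0 → inj₁ (inj₁ m<0)) ]′ (<-cotrans (neg-neg 0<q) m)

    located : Located Below
    located p<q =
      let m , p<m , m<q = between p<q
      in  [ (λ m∈ → inj₁ (m , m∈ , p<m)) , inj₂ ]′ (below-or-bound m<q)

    upperBound : IsUpperBound Below (a + 1#)
    upperBound = bounded 0<q (x+d (+-nonneg-pos (*-nonneg-pos 0≤a 0<q) 0<1) eq)
      where
      open ≈-Reasoning setoid
      q : Carrier
      q = a + 1#
      0<q : 0# < q
      0<q = +-nonneg-pos 0≤a 0<1
      eq : a + (a * q + 1#) ≈ q * q
      eq = begin
        a + (a * q + 1#)  ≈⟨ solve 3 (λ a b i → a :+ (b :+ i) := b :+ (a :+ i)) refl a (a * q) 1# ⟩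
        a * q + q         ≈⟨ +-congˡ (*-identityˡ q) ⟨
        a * q + 1# * q    ≈⟨ distribʳ q a 1# ⟨
        q * q             ∎

    module _ {s} (bound : IsUpperBound Below s)
             (exceeded : ∀ {y} → y < s → y ExceededIn Below) where

      0≤s : 0# ≤ s
      0≤s s<0 with between s<0
      ... | m , s<m , m<0 = bound m (inj₁ m<0) s<m

      s²≮a : a ≤ s * s
      s²≮a s²<a with diff s²<a
      ... | d , 0<d , s²+d≈a with small 0≤s 0<d
      ... | e , 0<e , e<1 , ek<d = bound (s + e) (inj₂ sq<a) (x+d 0<e refl)
        where
        sq<a : (s + e) * (s + e) < a
        sq<a = <-respˡ-≈
          (solve 2 (λ s e → s :* s :+ e :* (s :+ s :+ e) := (s :+ e) :* (s :+ e)) refl s e)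
          (<-respʳ-≈ s²+d≈a
            (+-monoʳ-< (s * s) (<-trans (*-monoʳ-< 0<e (+-monoʳ-< (s + s) e<1)) ek<d)))

      a≮s² : s * s ≤ a
      a≮s² a<s² with diff a<s²
      ... | d , 0<d , a+d≈s² with small 0≤s 0<d
      ... | e , 0<e , e<1 , ek<d = not-exceeded (exceeded t<s)
        where
        t : Carrier
        t = s - e

        t+e≈s : t + e ≈ s
        t+e≈s = trans (+-assoc s (- e) e) (trans (+-congˡ (-‿inverseˡ e)) (+-identityʳ s))

        t<s : t < s
        t<s = x+d 0<e t+e≈s

        0≤t : 0# ≤ t
        0≤t t<0 = 0≤a (+-cancel-< (<-respˡ-≈ (sym a+d≈s²) (<-respʳ-≈ (sym (+-identityˡ d)) s²<d)))
          where
          s<e : s < e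
          s<e = <-respˡ-≈ t+e≈s (<-respʳ-≈ (+-identityˡ e) (+-monoˡ-< e t<0))
          e<k : e < s + s + 1#
          e<k = <-≤-trans e<1 λ k<1 → *-nonneg-pos 0≤s 0<2
            (<-respˡ-≈ (solve 1 (λ s → s :+ s := s :* (con 1 :+ con 1)) refl s)
              (+-cancel-< (<-respʳ-≈ (sym (+-identityˡ 1#)) k<1)))
          s²<d : s * s < d
          s²<d = <-trans (square-mono⁺ 0≤s s<e) (<-trans (*-monoʳ-< 0<e e<k) ek<d)

        a<t² : a < t * t
        a<t² = +-cancel-< (<-respʳ-≈ eq (+-monoʳ-< a r<d))
          where
          r = e * (t + t + e)
          r<d : r < d
          r<d = <-trans (*-monoʳ-< 0<e (<-trans (+-monoˡ-< e (<-trans (+-monoˡ-< t t<s) (+-monoʳ-< s t<s)))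
                  (+-monoʳ-< (s + s) e<1))) ek<d
          open ≈-Reasoning setoid
          eq : a + d ≈ t * t + r
          eq = begin
            a + d              ≈⟨ a+d≈s² ⟩
            s * s              ≈⟨ *-cong t+e≈s t+e≈s ⟨
            (t + e) * (t + e)  ≈⟨ solve 2 (λ t e → (t :+ e) :* (t :+ e)
                                    := t :* t :+ e :* (t :+ t :+ e)) refl t e ⟩
            t * t + r          ∎

        not-exceeded : ¬ (t ExceededIn Below)
        not-exceeded (x , inj₁ x<0  , t<x) = 0≤t (<-trans t<x x<0)
        not-exceeded (x , inj₂ x²<a , t<x) =
          <-asym (<-trans x²<a a<t²) (square-mono⁺ 0≤t t<x)

      s²≈a : s * s ≈ a
      s²≈a = proj₁ (tight (s * s) a) [ s²≮a , a≮s² ]′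

    opaque
      squareRoot : ∃[ r ] 0# ≤ r × r * r ≈ a
      squareRoot =
        let s , bound , exceeded =
              complete Below (- 1# , inj₁ (neg-neg 0<1)) (a + 1# , upperBound) located
        in  s , 0≤s bound exceeded , s²≈a bound exceeded

  -- The argument is the proof that the radicand a is nonnegative.
  √_ : ∀ {a} → 0# ≤ a → Carrier
  √ 0≤a = proj₁ (squareRoot 0≤a)

  √3 : Carrier
  √3 = √ (<-asym 0<3)

record Graph (n : ℕ) : Set₁ where
  field
    Adj    : Rel (Fin n) 0ℓ
    sym    : Symmetric Adj
    irrefl : Irreflexive _≡_ Adj
    _adj?_ : Decidable Adj

K : ∀ n → Graph n
K n = record
  { Adj    = _≢_
  ; sym    = ≡.≢-sym
  ; irrefl = λ i≡j i≢j → i≢j i≡j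
  ; _adj?_ = λ i j → ¬? (i ≟ j)
  }

-- The new vertex is `zero`; an old vertex `i` becomes `suc i`.
appendLeaf : ∀ {n} → Graph n → Fin n → Graph (suc n)
appendLeaf {n} G v = record
  { Adj    = Adj′
  ; sym    = λ {i} {j} → sym′ {i} {j}
  ; irrefl = λ {i} {j} → irrefl′ {i} {j}
  ; _adj?_ = adj?′
  }
  where
  open Graph G

  Adj′ : Rel (Fin (suc n)) 0ℓ
  Adj′ zero    zero    = ⊥
  Adj′ zero    (suc j) = j ≡ v
  Adj′ (suc i) zero    = i ≡ v
  Adj′ (suc i) (suc j) = Adj i j

  sym′ : Symmetric Adj′
  sym′ {zero}  {suc j} e = e
  sym′ {suc i} {zero}  e = e
  sym′ {suc i} {suc j} e = sym e

  irrefl′ : Irreflexive _≡_ Adj′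
  irrefl′ {suc i} {suc .i} ≡.refl e = irrefl ≡.refl e

  adj?′ : Decidable Adj′
  adj?′ zero    zero    = no λ ()
  adj?′ zero    (suc j) = j ≟ v
  adj?′ (suc i) zero    = i ≟ v
  adj?′ (suc i) (suc j) = i adj? j

Paw : Graph 4
Paw = appendLeaf (K 3) zero

module Laplacian {c ℓ} (ℝ : Reals c ℓ) where
  open Reals ℝ hiding (zero)
  open CommutativeRing commutativeRing using (+-monoid; *-monoid)
  open MonoidSum +-monoid using (sum)
  open MonoidSum *-monoid using () renaming (sum to product)

  Matrix : ℕ → Set c
  Matrix n = Fin n → Fin n → Carrier

  -- (-1)ⁱ x
  alternate : ∀ {n} → Fin n → Carrier → Carrier
  alternate zero    x = x
  alternate (suc i) x = - alternate i x

  -- Laplace expansion along the first row.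
  det : ∀ {n} → Matrix n → Carrier
  det {zero}  A = 1#
  det {suc n} A = sum λ j →
    alternate j (A zero j * det λ i k → A (suc i) (punchIn j k))

  identity : ∀ {n} → Matrix n
  identity i j = if does (i ≟ j) then 1# else 0#

  charPoly : ∀ {n} → Matrix n → Carrier → Carrier
  charPoly A x = det λ i j → x * identity i j - A i j

  -- A multiset of n reals is given by a listing of its elements; the property
  -- below does not depend on the order.  The eigenvalues counted with
  -- algebraic multiplicity are the σ i with det (xI - A) = ∏ᵢ (x - σ i) as
  -- polynomials in x, which over an infinite field means for every value of x.
  IsSpectrum : ∀ {n} → Matrix n → Vector Carrier n → Set (c ⊔ ℓ)
  IsSpectrum A σ = ∀ x → charPoly A x ≈ product λ i → x - σ i

  record _∈𝒮ᴸ_ {n} (A : Matrix n) (G : Graph n) : Set ℓ where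
    open Graph G using (Adj)
    field
      symmetric : ∀ i j → A i j ≈ A j i
      edge      : ∀ {i j} → Adj i j → A i j < 0#
      nonEdge   : ∀ {i j} → i ≢ j → ¬ Adj i j → A i j ≈ 0#
      diagonal  : ∀ i → A i i ≈ - sum λ k → if does (k ≟ i) then 0# else A i k

  LaplacianRealizable : ∀ {n} → Graph n → Vector Carrier n → Set (c ⊔ ℓ)
  LaplacianRealizable {n} G σ = Σ (Matrix n) λ A → A ∈𝒮ᴸ G × IsSpectrum A σ

{-# OPTIONS --safe #-}

-- Let a be the weight of the leaf's edge and b, c, d those of the triangle, d
-- being opposite the leaf.  If lam is a double eigenvalue of the Laplacian A,
-- then lam − A is singular with traceless adjugate; as it is symmetric, the
-- squares of the entries of its adjugate add up to zero.  The vanishing of two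
-- of these entries says that bc + bd + cd = b lam = c lam, whence b = c and
-- lam = b + 2d.  The other coefficients of the characteristic polynomial then
-- give lam + μ = 2a + 3b and lam μ = 4ab, so that
-- lam² + μ² − 4 lam μ = (2a − 3b)² ≥ 0, which is the stated dichotomy.
-- Conversely, when this discriminant is nonnegative the equations for a, b and d
-- have a positive solution.

module Submission where

open import Defs
open import Algebra.Bundles using (CommutativeRing; RawRing)
open import Algebra.Solver.Ring.AlmostCommutativeRing
  using (fromCommutativeRing; _-Raw-AlmostCommutative⟶_)
import Algebra.Properties.AbelianGroup as AbelianGroupProperties
import Algebra.Properties.Monoid.Sum as MonoidSum
import Algebra.Properties.Ring as RingProperties
import Algebra.Properties.Semiring.Mult.TCOptimised as Mult
import Algebra.Solver.Ring as RingSolver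
open import Data.Bool.Base using (if_then_else_)
open import Data.Fin.Base using (Fin; zero; suc; punchIn)
open import Data.Fin.Patterns using (0F; 1F; 2F; 3F)
open import Data.Fin.Properties using (_≟_)
open import Data.Integer.Base as ℤ using (ℤ; +_; -[1+_]; 0ℤ; 1ℤ; -1ℤ)
import Data.Integer.Properties as ℤ
open import Data.Maybe.Base as Maybe using ()
open import Data.Nat.Base as ℕ using (ℕ; zero; suc)
import Data.Nat.Properties as ℕ
open import Data.Product using (_×_; ∃-syntax; _,_; proj₁; proj₂)
import Data.Sign.Base as Sign
open import Data.Sum as Sum using (_⊎_; inj₁; inj₂; [_,_]′)
open import Data.Vec.Functional using (Vector; _∷_; []; foldr)
open import Function.Base using (_∘_; id)
open import Function.Bundles using (_⇔_; mk⇔)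
open import Relation.Binary.PropositionalEquality as ≡ using (_≡_; _≢_)
import Relation.Binary.Reasoning.Setoid as ≈-Reasoning
open import Relation.Nullary.Decidable using (dec⇒maybe; yes; no; does)
open import Relation.Nullary.Negation using (¬_; contradiction)

-- A ring solver with integer coefficients.

module IntegerCoefficients {c ℓ} (R : CommutativeRing c ℓ) where
  open CommutativeRing R
  open RingProperties ring using (-‿distribˡ-*; -‿distribʳ-*; -‿involutive; -0#≈0#)
  open AbelianGroupProperties +-abelianGroup using () renaming (⁻¹-∙-comm to -‿+-comm)
  open Mult semiring using (×-homo-+; ×1-homo-*; 1+×) renaming (_×_ to _·_)
  open ≈-Reasoning setoid

  -- These multiples start at `1#` and add on the right, so `con (+ 2)`, `con (+ 3)` and `con (+ 4)`
  -- evaluate definitionally to `2#`, `3#` and `4#`.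
  ⟦_⟧ℤ : ℤ → Carrier
  ⟦ + n      ⟧ℤ = n · 1#
  ⟦ -[1+ n ] ⟧ℤ = - (suc n · 1#)

  neg-homo : ∀ i → ⟦ ℤ.- i ⟧ℤ ≈ - ⟦ i ⟧ℤ
  neg-homo (+ zero)   = sym -0#≈0#
  neg-homo (+ suc n)  = refl
  neg-homo (-[1+ n ]) = sym (-‿involutive _)

  ⊖-homo : ∀ m n → ⟦ m ℤ.⊖ n ⟧ℤ ≈ m · 1# - n · 1#
  ⊖-homo m       zero    = sym (trans (+-congˡ -0#≈0#) (+-identityʳ _))
  ⊖-homo zero    (suc n) = sym (+-identityˡ _)
  ⊖-homo (suc m) (suc n) = begin
    ⟦ suc m ℤ.⊖ suc n ⟧ℤ                ≡⟨ ≡.cong ⟦_⟧ℤ (ℤ.[1+m]⊖[1+n]≡m⊖n m n) ⟩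
    ⟦ m ℤ.⊖ n ⟧ℤ                        ≈⟨ ⊖-homo m n ⟩
    m · 1# - n · 1#                     ≈⟨ +-congʳ (+-identityʳ _) ⟨
    m · 1# + 0# - n · 1#                ≈⟨ +-congʳ (+-congˡ (-‿inverseʳ 1#)) ⟨
    m · 1# + (1# - 1#) - n · 1#         ≈⟨ +-congʳ (+-assoc _ _ _) ⟨
    m · 1# + 1# - 1# - n · 1#           ≈⟨ +-assoc _ _ _ ⟩
    m · 1# + 1# + (- 1# - n · 1#)       ≈⟨ +-cong (+-comm _ _) (-‿+-comm _ _) ⟩
    1# + m · 1# - (1# + n · 1#)         ≈⟨ +-cong (1+× m 1#) (-‿cong (1+× n 1#)) ⟨
    suc m · 1# - suc n · 1#             ∎

  +-homo : ∀ i j → ⟦ i ℤ.+ j ⟧ℤ ≈ ⟦ i ⟧ℤ + ⟦ j ⟧ℤ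
  +-homo (+ m)    (+ n)    = ×-homo-+ 1# m n
  +-homo (+ m)    -[1+ n ] = ⊖-homo m (suc n)
  +-homo -[1+ m ] (+ n)    = trans (⊖-homo n (suc m)) (+-comm _ _)
  +-homo -[1+ m ] -[1+ n ] = begin
    - (suc (suc (m ℕ.+ n)) · 1#)       ≡⟨ ≡.cong (λ k → - (suc k · 1#)) (≡.sym (ℕ.+-suc m n)) ⟩
    - ((suc m ℕ.+ suc n) · 1#)         ≈⟨ -‿cong (×-homo-+ 1# (suc m) (suc n)) ⟩
    - (suc m · 1# + suc n · 1#)        ≈⟨ -‿+-comm _ _ ⟨
    - (suc m · 1#) - suc n · 1#        ∎

  ◃-homo⁺ : ∀ n → ⟦ Sign.+ ℤ.◃ n ⟧ℤ ≈ n · 1#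
  ◃-homo⁺ n = reflexive (≡.cong ⟦_⟧ℤ (ℤ.+◃n≡+n n))

  ◃-homo⁻ : ∀ n → ⟦ Sign.- ℤ.◃ n ⟧ℤ ≈ - (n · 1#)
  ◃-homo⁻ n = trans (reflexive (≡.cong ⟦_⟧ℤ (ℤ.-◃n≡-n n))) (neg-homo (+ n))

  *-homo : ∀ i j → ⟦ i ℤ.* j ⟧ℤ ≈ ⟦ i ⟧ℤ * ⟦ j ⟧ℤ
  *-homo (+ m)    (+ n)    = trans (◃-homo⁺ (m ℕ.* n)) (×1-homo-* m n)
  *-homo (+ m)    -[1+ n ] = trans (◃-homo⁻ (m ℕ.* suc n))
    (trans (-‿cong (×1-homo-* m (suc n))) (-‿distribʳ-* _ _))
  *-homo -[1+ m ] (+ n)    = trans (◃-homo⁻ (suc m ℕ.* n))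
    (trans (-‿cong (×1-homo-* (suc m) n)) (-‿distribˡ-* _ _))
  *-homo -[1+ m ] -[1+ n ] = begin
    (suc m ℕ.* suc n) · 1#              ≈⟨ ×1-homo-* (suc m) (suc n) ⟩
    suc m · 1# * suc n · 1#             ≈⟨ -‿involutive _ ⟨
    - - (suc m · 1# * suc n · 1#)       ≈⟨ -‿cong (-‿distribʳ-* _ _) ⟩
    - (suc m · 1# * - (suc n · 1#))     ≈⟨ -‿distribˡ-* _ _ ⟩
    - (suc m · 1#) * - (suc n · 1#)     ∎

  homomorphism : ℤ.+-*-rawRing -Raw-AlmostCommutative⟶ fromCommutativeRing R
  homomorphism = record
    { ⟦_⟧    = ⟦_⟧ℤ
    ; +-homo = +-homo
    ; *-homo = *-homo
    ; -‿homo = neg-homo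
    ; 0-homo = refl
    ; 1-homo = refl
    }

  open RingSolver ℤ.+-*-rawRing (fromCommutativeRing R) homomorphism
    (λ i j → Maybe.map (reflexive ∘ ≡.cong ⟦_⟧ℤ) (dec⇒maybe (i ℤ.≟ j))) public
    using (Polynomial; solve; _:=_; _:+_; _:*_; _:-_; :-_; con)

  polynomialRing : ℕ → RawRing _ _
  polynomialRing n = record
    { Carrier = Polynomial n
    ; _≈_     = _≡_
    ; _+_     = _:+_
    ; _*_     = _:*_
    ; -_      = :-_
    ; 0#      = con 0ℤ
    ; 1#      = con 1ℤ
    }

-- Matrices, minors and coefficients over a raw ring.

-- The formulas are stated over a raw ring so that each can be read both in ℝ
-- and in the ring solver's syntax.
module Formulas {c ℓ} (R : RawRing c ℓ) where
  open RawRing R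

  2# 3# 4# : Carrier
  2# = 1# + 1#
  3# = 2# + 1#
  4# = 3# + 1#

  -- Repeats the Laplace expansion of `Laplacian.det`. At a concrete size both unfold to the same
  -- expression, so that an identity found by the solver applies to `charPoly`.
  det : ∀ {n} → (Fin n → Fin n → Carrier) → Carrier
  det {zero}  A = 1#
  det {suc n} A = foldr _+_ 0# λ j →
    alternate j (A zero j * det λ i k → A (suc i) (punchIn j k))
    where
    alternate : ∀ {n} → Fin n → Carrier → Carrier
    alternate zero    x = x
    alternate (suc i) x = - alternate i x

  charMatrix : ∀ {n} → (Fin n → Fin n → Carrier) → Carrier → Fin n → Fin n → Carrier
  charMatrix A x i j = x * (if does (i ≟ j) then 1# else 0#) + - A i j

  -- Up to sign, these are the adjugate entries indexed by the first row and column `j`, for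
  -- symmetric matrices.
  minor₀ : ∀ {n} → (Fin (suc n) → Fin (suc n) → Carrier) → Fin (suc n) → Carrier
  minor₀ A j = det λ i k → A (suc i) (punchIn j k)

  -- As in `appendLeaf`, vertex `0F` is the leaf and `1F` its neighbour; `a`, `b`, `c`, `d` weigh
  -- the edges 01, 12, 13, 23.
  paw : (a b c d : Carrier) → Fin 4 → Fin 4 → Carrier
  paw a b c d =
    (a   ∷ - a         ∷ 0#    ∷ 0#    ∷ []) ∷
    (- a ∷ a + b + c   ∷ - b   ∷ - c   ∷ []) ∷
    (0#  ∷ - b         ∷ b + d ∷ - d   ∷ []) ∷
    (0#  ∷ - c         ∷ - d   ∷ c + d ∷ []) ∷ []

  -- The coefficients of the characteristic polynomial of the Laplacian: eₖ sums
  -- the weights of the rooted spanning forests with k edges.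
  e₁ e₂ e₃ : (a b c d : Carrier) → Carrier
  e₁ a b c d = 2# * (a + b + c + d)
  e₂ a b c d = 3# * (a * b + a * c + b * c + b * d + c * d) + 4# * (a * d)
  e₃ a b c d = 4# * (a * (b * c + b * d + c * d))

  -- Horner forms of x⁴ - p x³ + q x² - r x and of its derivative. The constant term is zero because
  -- a Laplacian is singular.
  quartic quartic′ : (p q r x : Carrier) → Carrier
  quartic  p q r x = (((x + - p) * x + q) * x + - r) * x
  quartic′ p q r x = ((4# * x + - (3# * p)) * x + 2# * q) * x + - r

  symmetricMinor : ∀ {n} → (Fin n → Fin n → Carrier) → Fin n → Fin n → Carrier
  symmetricMinor A i j = A i i * A j j + - (A i j * A i j)

  -- The squared norm of the first row of the adjugate, and the sum of the principal 2×2 minors that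
  -- avoid index 0. The minors at `2F` and `3F` come first so that their vanishing can be peeled off
  -- in turn.
  minorNorm complementaryMinors : (Fin 4 → Fin 4 → Carrier) → Carrier
  minorNorm M =
    minor₀ M 2F * minor₀ M 2F + (minor₀ M 3F * minor₀ M 3F +
      (minor₀ M 0F * minor₀ M 0F + minor₀ M 1F * minor₀ M 1F))
  complementaryMinors M =
    symmetricMinor M 1F 2F + symmetricMinor M 1F 3F + symmetricMinor M 2F 3F

-- Squares, nonnegativity and cancellation in the ordered field.

module OrderedField {c ℓ} (ℝ : Reals c ℓ) where
  open Reals ℝ hiding (zero)
  open SquareRoot ℝ
  open IntegerCoefficients commutativeRing
  open ≈-Reasoning setoid

  ≤-respʳ-≈ : ∀ {x y z} → y ≈ z → x ≤ y → x ≤ z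
  ≤-respʳ-≈ y≈z x≤y z<x = x≤y (<-respˡ-≈ (sym y≈z) z<x)

  -- No case split on the sign of `x` is available. Instead, x² < 0 excludes both signs, so
  -- tightness gives x ≈ 0, whose square is not negative.
  0≤x² : ∀ x → 0# ≤ x * x
  0≤x² x x²<0 = <-irrefl (trans (*-congʳ x≈0) (zeroˡ x)) x²<0
    where
    x≈0 : x ≈ 0#
    x≈0 = proj₁ (tight x 0#)
      [ (λ x<0 → <-asym x²<0 (neg²-pos x<0)) , (λ 0<x → <-asym x²<0 (*-pos 0<x 0<x)) ]′

  -- Comparing x + y < 0 with `y` by cotransitivity makes either `x` or `y` negative.
  +-nonneg : ∀ {x y} → 0# ≤ x → 0# ≤ y → 0# ≤ x + y
  +-nonneg {x} {y} 0≤x 0≤y x+y<0 =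
    [ (λ x+y<y → 0≤x (+-cancel-< (<-respʳ-≈ (sym (+-identityˡ y)) x+y<y))) , 0≤y ]′
      (<-cotrans x+y<0 y)

  -- If `x` had either sign, its square and hence the sum would be positive; tightness does the
  -- rest.
  square+nonneg≈0⇒≈0 : ∀ {x y} → 0# ≤ y → x * x + y ≈ 0# → x ≈ 0#
  square+nonneg≈0⇒≈0 {x} {y} 0≤y eq = proj₁ (tight x 0#)
    [ (λ x<0 → impossible (neg²-pos x<0)) , (λ 0<x → impossible (*-pos 0<x 0<x)) ]′
    where
    impossible : ¬ 0# < x * x
    impossible 0<x² = <-irrefl (sym (trans (+-comm y (x * x)) eq)) (+-nonneg-pos 0≤y 0<x²)

  *-cancelˡ-≈ : ∀ {k x y} → 0# < k → k * x ≈ k * y → x ≈ y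
  *-cancelˡ-≈ {k} {x} {y} 0<k kx≈ky with pos-inverse 0<k
  ... | v , _ , kv≈1 = begin
    x            ≈⟨ eq x ⟩
    v * (k * x)  ≈⟨ *-congˡ kx≈ky ⟩
    v * (k * y)  ≈⟨ eq y ⟨
    y            ∎
    where
    eq : ∀ z → z ≈ v * (k * z)
    eq z = begin
      z            ≈⟨ *-identityˡ z ⟨
      1# * z       ≈⟨ *-congʳ kv≈1 ⟨
      k * v * z    ≈⟨ solve 3 (λ k v z → k :* v :* z := v :* (k :* z)) refl k v z ⟩
      v * (k * z)  ∎

  *-cancelˡ-pos : ∀ {k x} → 0# < k → 0# < k * x → 0# < x
  *-cancelˡ-pos {k} {x} 0<k 0<kx with pos-inverse 0<k
  ... | v , 0<v , kv≈1 = <-respʳ-≈ eq (*-pos 0<v 0<kx)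
    where
    eq : v * (k * x) ≈ x
    eq = begin
      v * (k * x)  ≈⟨ solve 3 (λ k v x → v :* (k :* x) := k :* v :* x) refl k v x ⟩
      k * v * x    ≈⟨ *-congʳ kv≈1 ⟩
      1# * x       ≈⟨ *-identityˡ x ⟩
      x            ∎

  x-y+y≈x : ∀ x y → x - y + y ≈ x
  x-y+y≈x = solve 2 (λ x y → x :- y :+ y := x) refl

  x≤y⇒0≤y-x : ∀ {x y} → x ≤ y → 0# ≤ y - x
  x≤y⇒0≤y-x {x} {y} x≤y y-x<0 =
    x≤y (<-respˡ-≈ (x-y+y≈x y x) (<-respʳ-≈ (+-identityˡ x) (+-monoˡ-< x y-x<0)))

  x<y⇒0<y-x : ∀ {x y} → x < y → 0# < y - x
  x<y⇒0<y-x {x} x<y = <-respˡ-≈ (-‿inverseʳ x) (+-monoˡ-< (- x) x<y)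

module PawSpectrum {c ℓ} (ℝ : Reals c ℓ) where
  open Reals ℝ hiding (zero)
  open CommutativeRing commutativeRing using (rawRing; *-monoid; +-monoid; ring)
  open RingProperties ring using (x∙y⁻¹≈ε⇒x≈y; x≈y⇒x∙y⁻¹≈ε; -‿involutive; -0#≈0#)
  open MonoidSum +-monoid using (sum; sum-cong-≋)
  open MonoidSum *-monoid using () renaming (sum to product)
  open SquareRoot ℝ
  open OrderedField ℝ
  open IntegerCoefficients commutativeRing
  open Laplacian ℝ
  open Formulas rawRing hiding (det; 2#; 3#)
  open _∈𝒮ᴸ_
  open ≈-Reasoning setoid

  -- n is the number of variables.
  module Poly (n : ℕ) = Formulas (polynomialRing n)

  -- The Laplacian matrices of the paw.

  det-cong : ∀ {n} {A B : Matrix n} → (∀ i j → A i j ≈ B i j) → det A ≈ det B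
  det-cong {zero}  A≈B = refl
  det-cong {suc n} A≈B = sum-cong-≋ λ j →
    alternate-cong j (*-cong (A≈B zero j) (det-cong λ i k → A≈B (suc i) (punchIn j k)))
    where
    alternate-cong : ∀ {n} (i : Fin n) {x y} → x ≈ y → alternate i x ≈ alternate i y
    alternate-cong zero    x≈y = x≈y
    alternate-cong (suc i) x≈y = -‿cong (alternate-cong i x≈y)

  charPoly-cong : ∀ {n} {A B : Matrix n} → (∀ i j → A i j ≈ B i j) →
                  ∀ x → charPoly A x ≈ charPoly B x
  charPoly-cong A≈B x = det-cong λ i j → +-congˡ (-‿cong (A≈B i j))

  -- Zero row sums determine the diagonal from the other entries.
  ∈𝒮ᴸ-ext : ∀ {n} {G : Graph n} {A B : Matrix n} → A ∈𝒮ᴸ G → B ∈𝒮ᴸ G →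
            (∀ {i j} → i ≢ j → A i j ≈ B i j) → ∀ i j → A i j ≈ B i j
  ∈𝒮ᴸ-ext {A = A} {B} A∈ B∈ A≈B i j with i ≟ j
  ... | no  i≢j    = A≈B i≢j
  ... | yes ≡.refl = begin
    A i i                                             ≈⟨ diagonal A∈ i ⟩
    - sum (λ k → if does (k ≟ i) then 0# else A i k)  ≈⟨ -‿cong (sum-cong-≋ off) ⟩
    - sum (λ k → if does (k ≟ i) then 0# else B i k)  ≈⟨ diagonal B∈ i ⟨
    B i i                                             ∎
    where
    off : ∀ k → (if does (k ≟ i) then 0# else A i k) ≈ (if does (k ≟ i) then 0# else B i k)
    off k with k ≟ i
    ... | yes _   = refl
    ... | no  k≢i = A≈B (k≢i ∘ ≡.sym)

  paw∈𝒮ᴸ : ∀ {a b c d} → 0# < a → 0# < b → 0# < c → 0# < d → paw a b c d ∈𝒮ᴸ Paw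
  paw∈𝒮ᴸ {a} {b} {c} {d} 0<a 0<b 0<c 0<d = record
    { symmetric = sym′ ; edge = λ {i} {j} → edge′ {i} {j}
    ; nonEdge = λ {i} {j} → nonEdge′ {i} {j} ; diagonal = diagonal′ }
    where
    A : Matrix 4
    A = paw a b c d

    sym′ : ∀ i j → A i j ≈ A j i
    sym′ 0F 0F = refl
    sym′ 0F 1F = refl
    sym′ 0F 2F = refl
    sym′ 0F 3F = refl
    sym′ 1F 0F = refl
    sym′ 1F 1F = refl
    sym′ 1F 2F = refl
    sym′ 1F 3F = refl
    sym′ 2F 0F = refl
    sym′ 2F 1F = refl
    sym′ 2F 2F = refl
    sym′ 2F 3F = refl
    sym′ 3F 0F = refl
    sym′ 3F 1F = refl
    sym′ 3F 2F = refl
    sym′ 3F 3F = refl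

    edge′ : ∀ {i j} → Graph.Adj Paw i j → A i j < 0#
    edge′ {0F} {1F} _ = neg-neg 0<a
    edge′ {1F} {0F} _ = neg-neg 0<a
    edge′ {1F} {2F} _ = neg-neg 0<b
    edge′ {1F} {3F} _ = neg-neg 0<c
    edge′ {2F} {1F} _ = neg-neg 0<b
    edge′ {2F} {3F} _ = neg-neg 0<d
    edge′ {3F} {1F} _ = neg-neg 0<c
    edge′ {3F} {2F} _ = neg-neg 0<d
    edge′ {1F} {1F} e = contradiction ≡.refl e
    edge′ {2F} {2F} e = contradiction ≡.refl e
    edge′ {3F} {3F} e = contradiction ≡.refl e

    nonEdge′ : ∀ {i j} → i ≢ j → ¬ Graph.Adj Paw i j → A i j ≈ 0#
    nonEdge′ {0F} {2F} _ _ = refl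
    nonEdge′ {0F} {3F} _ _ = refl
    nonEdge′ {2F} {0F} _ _ = refl
    nonEdge′ {3F} {0F} _ _ = refl
    nonEdge′ {0F} {0F} i≢i _ = contradiction ≡.refl i≢i
    nonEdge′ {0F} {1F} _ ¬e = contradiction ≡.refl ¬e
    nonEdge′ {1F} {0F} _ ¬e = contradiction ≡.refl ¬e
    nonEdge′ {suc i} {suc j} i≢j ¬e = contradiction (i≢j ∘ ≡.cong suc) ¬e

    diagonal′ : ∀ i → A i i ≈ - sum λ k → if does (k ≟ i) then 0# else A i k
    diagonal′ 0F = solve 1 (λ a →
      a := :- (con 0ℤ :+ (:- a :+ (con 0ℤ :+ (con 0ℤ :+ con 0ℤ))))) refl a
    diagonal′ 1F = solve 3 (λ a b c →
      a :+ b :+ c := :- (:- a :+ (con 0ℤ :+ (:- b :+ (:- c :+ con 0ℤ))))) refl a b c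
    diagonal′ 2F = solve 2 (λ b d →
      b :+ d := :- (con 0ℤ :+ (:- b :+ (con 0ℤ :+ (:- d :+ con 0ℤ))))) refl b d
    diagonal′ 3F = solve 2 (λ c d →
      c :+ d := :- (con 0ℤ :+ (:- c :+ (:- d :+ (con 0ℤ :+ con 0ℤ))))) refl c d

  ∈𝒮ᴸ⇒paw : ∀ {A} → A ∈𝒮ᴸ Paw → ∃[ a ] ∃[ b ] ∃[ c ] ∃[ d ]
    (0# < a × 0# < b × 0# < c × 0# < d × (∀ i j → A i j ≈ paw a b c d i j))
  ∈𝒮ᴸ⇒paw {A} A∈ = - A 0F 1F , - A 1F 2F , - A 1F 3F , - A 2F 3F
    , 0<a , 0<b , 0<c , 0<d , ∈𝒮ᴸ-ext A∈ (paw∈𝒮ᴸ 0<a 0<b 0<c 0<d) off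
    where
    0<a : 0# < - A 0F 1F
    0<a = neg-pos (edge A∈ ≡.refl)
    0<b : 0# < - A 1F 2F
    0<b = neg-pos (edge A∈ λ ())
    0<c : 0# < - A 1F 3F
    0<c = neg-pos (edge A∈ λ ())
    0<d : 0# < - A 2F 3F
    0<d = neg-pos (edge A∈ λ ())

    upper : ∀ i j → A i j ≈ - - A i j
    upper i j = sym (-‿involutive (A i j))

    lower : ∀ i j → A j i ≈ - - A i j
    lower i j = trans (symmetric A∈ j i) (upper i j)

    off : ∀ {i j} → i ≢ j → A i j ≈ paw (- A 0F 1F) (- A 1F 2F) (- A 1F 3F) (- A 2F 3F) i j
    off {0F} {1F} _ = upper 0F 1F
    off {0F} {2F} i≢j = nonEdge A∈ i≢j λ ()
    off {0F} {3F} i≢j = nonEdge A∈ i≢j λ ()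
    off {1F} {0F} _ = lower 0F 1F
    off {1F} {2F} _ = upper 1F 2F
    off {1F} {3F} _ = upper 1F 3F
    off {2F} {0F} i≢j = nonEdge A∈ i≢j λ ()
    off {2F} {1F} _ = lower 1F 2F
    off {2F} {3F} _ = upper 2F 3F
    off {3F} {0F} i≢j = nonEdge A∈ i≢j λ ()
    off {3F} {1F} _ = lower 1F 3F
    off {3F} {2F} _ = lower 2F 3F
    off {0F} {0F} i≢i = contradiction ≡.refl i≢i
    off {1F} {1F} i≢i = contradiction ≡.refl i≢i
    off {2F} {2F} i≢i = contradiction ≡.refl i≢i
    off {3F} {3F} i≢i = contradiction ≡.refl i≢i

  -- Characteristic polynomial and minors of the weighted paw.

  charPoly-paw : ∀ a b c d x → charPoly (paw a b c d) x ≈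
    quartic (e₁ a b c d) (e₂ a b c d) (e₃ a b c d) x
  charPoly-paw = solve 5 (λ a b c d x →
    Poly.det 5 (Poly.charMatrix 5 (Poly.paw 5 a b c d) x) :=
    Poly.quartic 5 (Poly.e₁ 5 a b c d) (Poly.e₂ 5 a b c d) (Poly.e₃ 5 a b c d) x) refl

  -- With equal weights on 12 and 13, the vector (0, 0, 1, -1) is an eigenvector for b + 2d. The
  -- other factors come from the vectors symmetric in the last two coordinates.
  charPoly-isosceles : ∀ a b d x → charPoly (paw a b b d) x ≈
    x * ((x - (b + 2# * d)) * (x * x - (2# * a + 3# * b) * x + 4# * (a * b)))
  charPoly-isosceles = solve 4 (λ a b d x →
    Poly.det 4 (Poly.charMatrix 4 (Poly.paw 4 a b b d) x) :=
    x :* ((x :- (b :+ con (+ 2) :* d)) :*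
      (x :* x :- (con (+ 2) :* a :+ con (+ 3) :* b) :* x :+ con (+ 4) :* (a :* b)))) refl

  -- Jacobi's identity: (adj M)₀ⱼ² is (adj M)₀₀ (adj M)ⱼⱼ minus det M times the complementary 2×2
  -- minor, for j ≠ 0. Summing over j produces the trace of the adjugate, which is `quartic′` at
  -- `x`, while det M is `quartic` at `x`.
  minorNorm≈ : ∀ a b c d x → let M = charMatrix (paw a b c d) x in
    minorNorm M ≈ minor₀ M 0F * quartic′ (e₁ a b c d) (e₂ a b c d) (e₃ a b c d) x -
                  complementaryMinors M * quartic (e₁ a b c d) (e₂ a b c d) (e₃ a b c d) x
  minorNorm≈ = solve 5 (λ a b c d x → let M = Poly.charMatrix 5 (Poly.paw 5 a b c d) x in
    Poly.minorNorm 5 M :=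
    Poly.minor₀ 5 M 0F :*
      Poly.quartic′ 5 (Poly.e₁ 5 a b c d) (Poly.e₂ 5 a b c d) (Poly.e₃ 5 a b c d) x :-
    Poly.complementaryMinors 5 M :*
      Poly.quartic 5 (Poly.e₁ 5 a b c d) (Poly.e₂ 5 a b c d) (Poly.e₃ 5 a b c d) x) refl

  -- Below row 0, column 0 has the single nonzero entry `a`, which leaves `a` times a 2×2
  -- determinant; likewise in `minor₀-3F≈`.
  minor₀-2F≈ : ∀ a b c d x →
    minor₀ (charMatrix (paw a b c d) x) 2F ≈ a * (b * x - (b * c + b * d + c * d))
  minor₀-2F≈ = solve 5 (λ a b c d x →
    Poly.minor₀ 5 (Poly.charMatrix 5 (Poly.paw 5 a b c d) x) 2F :=
    a :* (b :* x :- (b :* c :+ b :* d :+ c :* d))) refl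

  minor₀-3F≈ : ∀ a b c d x →
    minor₀ (charMatrix (paw a b c d) x) 3F ≈ a * (b * c + b * d + c * d - c * x)
  minor₀-3F≈ = solve 5 (λ a b c d x →
    Poly.minor₀ 5 (Poly.charMatrix 5 (Poly.paw 5 a b c d) x) 3F :=
    a :* (b :* c :+ b :* d :+ c :* d :- c :* x)) refl

  -- Comparing coefficients of quartics.

  quartic-cong : ∀ {p q r p′ q′ r′} → p ≈ p′ → q ≈ q′ → r ≈ r′ →
                 ∀ x → quartic p q r x ≈ quartic p′ q′ r′ x
  quartic-cong p≈ q≈ r≈ x =
    *-congʳ (+-cong (*-congʳ (+-cong (*-congʳ (+-congˡ (-‿cong p≈))) q≈)) (-‿cong r≈))

  quartic′-cong : ∀ {p q r p′ q′ r′} → p ≈ p′ → q ≈ q′ → r ≈ r′ →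
                  ∀ x → quartic′ p q r x ≈ quartic′ p′ q′ r′ x
  quartic′-cong p≈ q≈ r≈ x =
    +-cong (*-congʳ (+-cong (*-congʳ (+-congˡ (-‿cong (*-congˡ p≈)))) (*-congˡ q≈))) (-‿cong r≈)

  -- The values at 1, −1 and 2 determine six times the coefficients.
  quartic-injective : ∀ {p q r p′ q′ r′} → (∀ x → quartic p q r x ≈ quartic p′ q′ r′ x) →
                      p ≈ p′ × q ≈ q′ × r ≈ r′
  quartic-injective {p} {q} {r} {p′} {q′} {r′} eq =
      -- The multipliers 1 and 0 are written out so that all three combinations have the shape
      -- expected by `coefficient`.
      coefficient (solve 6 (λ p q r p′ q′ r′ → let at = difference p q r p′ q′ r′ in
        con (+ 6) :* (p :- p′) := con (+ 3) :* at 1ℤ :+ con 1ℤ :* at -1ℤ :+ con -1ℤ :* at (+ 2))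
        refl p q r p′ q′ r′)
    , coefficient (solve 6 (λ p q r p′ q′ r′ → let at = difference p q r p′ q′ r′ in
        con (+ 6) :* (q :- q′) := con (+ 3) :* at 1ℤ :+ con (+ 3) :* at -1ℤ :+ con 0ℤ :* at (+ 2))
        refl p q r p′ q′ r′)
    , coefficient (solve 6 (λ p q r p′ q′ r′ → let at = difference p q r p′ q′ r′ in
        con (+ 6) :* (r :- r′) := con -[1+ 5 ] :* at 1ℤ :+ con (+ 2) :* at -1ℤ :+ con 1ℤ :* at (+ 2))
        refl p q r p′ q′ r′)
    where
    difference : (p q r p′ q′ r′ : Polynomial 6) → ℤ → Polynomial 6
    difference p q r p′ q′ r′ i =
      Poly.quartic 6 p q r (con i) :- Poly.quartic 6 p′ q′ r′ (con i)

    0<6 : 0# < ⟦ + 6 ⟧ℤ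
    0<6 = +-pos (+-pos (+-pos 0<3 0<1) 0<1) 0<1

    vanishes : ∀ x → quartic p q r x - quartic p′ q′ r′ x ≈ 0#
    vanishes x = x≈y⇒x∙y⁻¹≈ε (eq x)

    coefficient : ∀ {y y′ u v w} → ⟦ + 6 ⟧ℤ * (y - y′) ≈
      u * (quartic p q r 1# - quartic p′ q′ r′ 1#) +
      v * (quartic p q r (- 1#) - quartic p′ q′ r′ (- 1#)) +
      w * (quartic p q r 2# - quartic p′ q′ r′ 2#) → y ≈ y′
    coefficient {y} {y′} {u} {v} {w} 6[y-y′]≈ = x∙y⁻¹≈ε⇒x≈y y y′ (*-cancelˡ-≈ 0<6 (begin
      ⟦ + 6 ⟧ℤ * (y - y′)
        ≈⟨ 6[y-y′]≈ ⟩
      _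
        ≈⟨ +-cong (+-cong (*-congˡ (vanishes 1#)) (*-congˡ (vanishes (- 1#))))
             (*-congˡ (vanishes 2#)) ⟩
      u * 0# + v * 0# + w * 0#
        ≈⟨ solve 3 (λ u v w → u :* con 0ℤ :+ v :* con 0ℤ :+ w :* con 0ℤ
             := con (+ 6) :* con 0ℤ) refl u v w ⟩
      ⟦ + 6 ⟧ℤ * 0# ∎))

  -- The multiset 0, lam, lam, μ.

  module _ {lam μ : Carrier} where

    σ : Vector Carrier 4
    σ = 0# ∷ lam ∷ lam ∷ μ ∷ []

    -- Elementary symmetric functions of `σ`; the fourth is zero.
    f₁ f₂ f₃ : Carrier
    f₁ = lam + lam + μ
    f₂ = lam * lam + 2# * (lam * μ)
    f₃ = lam * lam * μ

    product-quartic : ∀ x → product (λ i → x - σ i) ≈ quartic f₁ f₂ f₃ x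
    product-quartic x = solve 3 (λ l m x →
      (x :- con 0ℤ) :* ((x :- l) :* ((x :- l) :* ((x :- m) :* con 1ℤ))) :=
      Poly.quartic 3 (l :+ l :+ m) (l :* l :+ con (+ 2) :* (l :* m)) (l :* l :* m) x) refl lam μ x

    quartic-lam≈0 : quartic f₁ f₂ f₃ lam ≈ 0#
    quartic-lam≈0 = solve 2 (λ l m →
      Poly.quartic 2 (l :+ l :+ m) (l :* l :+ con (+ 2) :* (l :* m)) (l :* l :* m) l :=
      con 0ℤ) refl lam μ

    quartic′-lam≈0 : quartic′ f₁ f₂ f₃ lam ≈ 0#
    quartic′-lam≈0 = solve 2 (λ l m →
      Poly.quartic′ 2 (l :+ l :+ m) (l :* l :+ con (+ 2) :* (l :* m)) (l :* l :* m) l :=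
      con 0ℤ) refl lam μ

    -- A quarter of the discriminant of 6b² - 2(lam + μ)b + lam μ, the quadratic satisfied by the
    -- weight `b`.
    discriminant : Carrier
    discriminant = lam * lam + μ * μ - 4# * (lam * μ)

    module _ (0<lam : 0# < lam) where

      -- Necessity: the weights forced by a double eigenvalue.

      module _ {a b c d} (0<a : 0# < a) (0<b : 0# < b) (0<c : 0# < c)
               (spectrum : IsSpectrum (paw a b c d) σ) where

        T : Carrier
        T = b * c + b * d + c * d

        M : Matrix 4
        M = charMatrix (paw a b c d) lam

        coefficients : e₁ a b c d ≈ f₁ × e₂ a b c d ≈ f₂ × e₃ a b c d ≈ f₃
        coefficients = quartic-injective λ x → begin
          quartic (e₁ a b c d) (e₂ a b c d) (e₃ a b c d) x  ≈⟨ charPoly-paw a b c d x ⟨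
          charPoly (paw a b c d) x                          ≈⟨ spectrum x ⟩
          product (λ i → x - σ i)                           ≈⟨ product-quartic x ⟩
          quartic f₁ f₂ f₃ x                                ∎

        -- For symmetric M, (adj M)ᵢⱼ² and (adj M)ᵢᵢ (adj M)ⱼⱼ differ by a multiple
        -- of det M, so minorNorm M is (adj M)₀₀ tr (adj M) up to such a multiple.
        -- The trace is the derivative of the characteristic polynomial, which
        -- vanishes at the double root lam.
        minorNorm≈0 : minorNorm M ≈ 0#
        minorNorm≈0 = let e₁≈ , e₂≈ , e₃≈ = coefficients in begin
          minorNorm M
            ≈⟨ minorNorm≈ a b c d lam ⟩
          minor₀ M 0F * quartic′ (e₁ a b c d) (e₂ a b c d) (e₃ a b c d) lam -
          complementaryMinors M * quartic (e₁ a b c d) (e₂ a b c d) (e₃ a b c d) lam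
            ≈⟨ +-cong (*-congˡ (trans (quartic′-cong e₁≈ e₂≈ e₃≈ lam) quartic′-lam≈0))
                 (-‿cong (*-congˡ (trans (quartic-cong e₁≈ e₂≈ e₃≈ lam) quartic-lam≈0))) ⟩
          minor₀ M 0F * 0# - complementaryMinors M * 0#
            ≈⟨ +-cong (zeroʳ _) (trans (-‿cong (zeroʳ _)) -0#≈0#) ⟩
          0# + 0#
            ≈⟨ +-identityˡ 0# ⟩
          0# ∎

        minor₀-2F≈0 : minor₀ M 2F ≈ 0#
        minor₀-2F≈0 = square+nonneg≈0⇒≈0
          (+-nonneg (0≤x² _) (+-nonneg (0≤x² _) (0≤x² _))) minorNorm≈0

        minor₀-3F≈0 : minor₀ M 3F ≈ 0#
        minor₀-3F≈0 = square+nonneg≈0⇒≈0 (+-nonneg (0≤x² _) (0≤x² _)) (begin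
          rest                                   ≈⟨ +-identityˡ rest ⟨
          0# + rest                              ≈⟨ +-congʳ (zeroʳ _) ⟨
          minor₀ M 2F * 0# + rest                ≈⟨ +-congʳ (*-congˡ minor₀-2F≈0) ⟨
          minorNorm M                            ≈⟨ minorNorm≈0 ⟩
          0#                                     ∎)
          where
          rest : Carrier
          rest = minor₀ M 3F * minor₀ M 3F +
            (minor₀ M 0F * minor₀ M 0F + minor₀ M 1F * minor₀ M 1F)

        b*lam≈T : b * lam ≈ T
        b*lam≈T = x∙y⁻¹≈ε⇒x≈y _ _ (*-cancelˡ-≈ 0<a
          (trans (sym (minor₀-2F≈ a b c d lam)) (trans minor₀-2F≈0 (sym (zeroʳ a)))))

        T≈c*lam : T ≈ c * lam
        T≈c*lam = x∙y⁻¹≈ε⇒x≈y _ _ (*-cancelˡ-≈ 0<a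
          (trans (sym (minor₀-3F≈ a b c d lam)) (trans minor₀-3F≈0 (sym (zeroʳ a)))))

        b≈c : b ≈ c
        b≈c = *-cancelˡ-≈ 0<lam (begin
          lam * b  ≈⟨ *-comm lam b ⟩
          b * lam  ≈⟨ trans b*lam≈T T≈c*lam ⟩
          c * lam  ≈⟨ *-comm c lam ⟩
          lam * c  ∎)

        lam≈c+2d : lam ≈ c + 2# * d
        lam≈c+2d = *-cancelˡ-≈ 0<c (begin
          c * lam                ≈⟨ T≈c*lam ⟨
          b * c + b * d + c * d  ≈⟨ +-congʳ (+-cong (*-congʳ b≈c) (*-congʳ b≈c)) ⟩
          c * c + c * d + c * d  ≈⟨ solve 2 (λ c d → c :* c :+ c :* d :+ c :* d
                                      := c :* (c :+ con (+ 2) :* d)) refl c d ⟩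
          c * (c + 2# * d)       ∎)

        -- The trace `e₁`, with one eigenvalue lam = c + 2d removed.
        lam+μ≈ : lam + μ ≈ 2# * a + 3# * c
        lam+μ≈ = begin
          lam + μ
            ≈⟨ solve 2 (λ l m → l :+ m := l :+ l :+ m :- l) refl lam μ ⟩
          f₁ - lam
            ≈⟨ +-cong (sym (proj₁ coefficients)) (-‿cong lam≈c+2d) ⟩
          2# * (a + b + c + d) - (c + 2# * d)
            ≈⟨ +-congʳ (*-congˡ (+-congʳ (+-congʳ (+-congˡ b≈c)))) ⟩
          2# * (a + c + c + d) - (c + 2# * d)
            ≈⟨ solve 3 (λ a c d → con (+ 2) :* (a :+ c :+ c :+ d) :- (c :+ con (+ 2) :* d)
                 := con (+ 2) :* a :+ con (+ 3) :* c) refl a c d ⟩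
          2# * a + 3# * c ∎

        -- Equality of `e₃` and `f₃` reads 4aT = lam² μ; substituting T = c lam leaves a factor
        -- `lam` to cancel.
        lam*μ≈ : lam * μ ≈ 4# * (a * c)
        lam*μ≈ = *-cancelˡ-≈ 0<lam (begin
          lam * (lam * μ)       ≈⟨ *-assoc lam lam μ ⟨
          f₃                    ≈⟨ proj₂ (proj₂ coefficients) ⟨
          4# * (a * T)          ≈⟨ *-congˡ (*-congˡ T≈c*lam) ⟩
          4# * (a * (c * lam))  ≈⟨ solve 3 (λ a c l → con (+ 4) :* (a :* (c :* l))
                                     := l :* (con (+ 4) :* (a :* c))) refl a c lam ⟩
          lam * (4# * (a * c))  ∎)

        μ-pos : 0# < μ
        μ-pos = *-cancelˡ-pos 0<lam
          (<-respʳ-≈ (sym lam*μ≈) (*-pos (+-pos 0<3 0<1) (*-pos 0<a 0<c)))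

        -- Both sides equal (lam + μ)² - 6 lam μ, by the sum and product just found.
        discriminant≈square : (2# * a - 3# * c) * (2# * a - 3# * c) ≈ discriminant
        discriminant≈square = begin
          (2# * a - 3# * c) * (2# * a - 3# * c)
            ≈⟨ solve 2 (λ a c →
                 (con (+ 2) :* a :- con (+ 3) :* c) :* (con (+ 2) :* a :- con (+ 3) :* c)
                 := (con (+ 2) :* a :+ con (+ 3) :* c) :* (con (+ 2) :* a :+ con (+ 3) :* c)
                    :- con (+ 6) :* (con (+ 4) :* (a :* c))) refl a c ⟩
          (2# * a + 3# * c) * (2# * a + 3# * c) - ⟦ + 6 ⟧ℤ * (4# * (a * c))
            ≈⟨ +-cong (*-cong lam+μ≈ lam+μ≈) (-‿cong (*-congˡ lam*μ≈)) ⟨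
          (lam + μ) * (lam + μ) - ⟦ + 6 ⟧ℤ * (lam * μ)
            ≈⟨ solve 2 (λ l m → (l :+ m) :* (l :+ m) :- con (+ 6) :* (l :* m)
                 := l :* l :+ m :* m :- con (+ 4) :* (l :* m)) refl lam μ ⟩
          discriminant ∎

      realizable⇒discriminant≥0 : LaplacianRealizable Paw σ → 0# < μ × 0# ≤ discriminant
      realizable⇒discriminant≥0 (A , A∈ , spectrum) =
        let a , b , c , d , 0<a , 0<b , 0<c , _ , A≈ = ∈𝒮ᴸ⇒paw A∈
            spectrum′ : IsSpectrum (paw a b c d) σ
            spectrum′ x = trans (sym (charPoly-cong A≈ x)) (spectrum x)
        in  μ-pos 0<a 0<b 0<c spectrum′ ,
            ≤-respʳ-≈ (discriminant≈square 0<a 0<b 0<c spectrum′) (0≤x² _)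

      -- Sufficiency: positive weights from a nonnegative discriminant.

      -- The multiset determines the weights up to the choice of a root of
      -- 6b² − 2(lam + μ)b + lam μ; this is the smaller root, written without
      -- subtraction.
      module _ {D S w h : Carrier} (0<S : 0# < S) (S≈ : S ≈ D + (lam + μ))
               (D²≈ : D * D ≈ discriminant) (Sw≈1 : S * w ≈ 1#) (2h≈1 : 2# * h ≈ 1#) where

        -- Here w = 1/S and h = 1/2. Thus A₀ = S/4 solves 4 A₀ B₀ = lam μ, and D₀ is (lam - B₀)/2
        -- rewritten with S - μ = D + lam, which makes its positivity visible.
        A₀ B₀ D₀ : Carrier
        A₀ = S * (h * h)
        B₀ = lam * μ * w
        D₀ = (D + lam) * lam * (w * h)

        B₀+2D₀≈ : B₀ + 2# * D₀ ≈ lam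
        B₀+2D₀≈ = begin
          B₀ + 2# * D₀
            ≈⟨ solve 5 (λ l m D w h → l :* m :* w :+ con (+ 2) :* ((D :+ l) :* l :* (w :* h))
                 := l :* m :* w :+ (D :+ l) :* l :* w :* (con (+ 2) :* h)) refl lam μ D w h ⟩
          lam * μ * w + (D + lam) * lam * w * (2# * h)
            ≈⟨ +-congˡ (*-congˡ 2h≈1) ⟩
          lam * μ * w + (D + lam) * lam * w * 1#
            ≈⟨ solve 4 (λ l m D w → l :* m :* w :+ (D :+ l) :* l :* w :* con 1ℤ
                 := l :* ((D :+ (l :+ m)) :* w)) refl lam μ D w ⟩
          lam * ((D + (lam + μ)) * w)
            ≈⟨ *-congˡ (*-congʳ S≈) ⟨
          lam * (S * w)
            ≈⟨ *-congˡ Sw≈1 ⟩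
          lam * 1#
            ≈⟨ *-identityʳ lam ⟩
          lam ∎

        4A₀B₀≈ : 4# * (A₀ * B₀) ≈ lam * μ
        4A₀B₀≈ = begin
          4# * (A₀ * B₀)
            ≈⟨ solve 4 (λ S h w k → con (+ 4) :* (S :* (h :* h) :* (k :* w))
                 := (con (+ 2) :* h) :* (con (+ 2) :* h) :* (S :* w) :* k) refl S h w (lam * μ) ⟩
          2# * h * (2# * h) * (S * w) * (lam * μ)
            ≈⟨ *-congʳ (*-cong (*-cong 2h≈1 2h≈1) Sw≈1) ⟩
          1# * 1# * 1# * (lam * μ)
            ≈⟨ solve 1 (λ k → con 1ℤ :* con 1ℤ :* con 1ℤ :* k := k) refl (lam * μ) ⟩
          lam * μ ∎

        -- Multiplied by 2S, this becomes S² + 6 lam μ = 2S (lam + μ), whose two sides differ by D²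
        -- - `discriminant`.
        2A₀+3B₀≈ : 2# * A₀ + 3# * B₀ ≈ lam + μ
        2A₀+3B₀≈ = *-cancelˡ-≈ (*-pos 0<2 0<S) (begin
          2# * S * (2# * A₀ + 3# * B₀)
            ≈⟨ solve 4 (λ S h w k →
                 con (+ 2) :* S :* (con (+ 2) :* (S :* (h :* h)) :+ con (+ 3) :* (k :* w)) :=
                 S :* S :* ((con (+ 2) :* h) :* (con (+ 2) :* h)) :+ con (+ 6) :* k :* (S :* w))
                 refl S h w (lam * μ) ⟩
          S * S * (2# * h * (2# * h)) + ⟦ + 6 ⟧ℤ * (lam * μ) * (S * w)
            ≈⟨ +-cong (*-cong (*-cong S≈ S≈) (*-cong 2h≈1 2h≈1)) (*-congˡ Sw≈1) ⟩
          (D + (lam + μ)) * (D + (lam + μ)) * (1# * 1#) + ⟦ + 6 ⟧ℤ * (lam * μ) * 1#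
            ≈⟨ solve 3 (λ D l m →
                 (D :+ (l :+ m)) :* (D :+ (l :+ m)) :* (con 1ℤ :* con 1ℤ)
                   :+ con (+ 6) :* (l :* m) :* con 1ℤ :=
                 con (+ 2) :* (D :+ (l :+ m)) :* (l :+ m)
                   :+ (D :* D :- (l :* l :+ m :* m :- con (+ 4) :* (l :* m)))) refl D lam μ ⟩
          2# * (D + (lam + μ)) * (lam + μ) + (D * D - discriminant)
            ≈⟨ +-cong (*-congʳ (*-congˡ (sym S≈))) (x≈y⇒x∙y⁻¹≈ε D²≈) ⟩
          2# * S * (lam + μ) + 0#
            ≈⟨ +-identityʳ _ ⟩
          2# * S * (lam + μ) ∎)

        -- The linear factor supplies one copy of `lam`; the quadratic factor supplies the other and
        -- `μ`.
        spectrum₀ : IsSpectrum (paw A₀ B₀ B₀ D₀) σ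
        spectrum₀ x = begin
          charPoly (paw A₀ B₀ B₀ D₀) x
            ≈⟨ charPoly-isosceles A₀ B₀ D₀ x ⟩
          x * ((x - (B₀ + 2# * D₀)) * (x * x - (2# * A₀ + 3# * B₀) * x + 4# * (A₀ * B₀)))
            ≈⟨ *-congˡ (*-cong (+-congˡ (-‿cong B₀+2D₀≈))
                 (+-cong (+-congˡ (-‿cong (*-congʳ 2A₀+3B₀≈))) 4A₀B₀≈)) ⟩
          x * ((x - lam) * (x * x - (lam + μ) * x + lam * μ))
            ≈⟨ solve 3 (λ l m x → x :* ((x :- l) :* (x :* x :- (l :+ m) :* x :+ l :* m)) :=
                 (x :- con 0ℤ) :* ((x :- l) :* ((x :- l) :* ((x :- m) :* con 1ℤ)))) refl lam μ x ⟩
          product (λ i → x - σ i) ∎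

      discriminant≥0⇒realizable : 0# < μ → 0# ≤ discriminant → LaplacianRealizable Paw σ
      discriminant≥0⇒realizable 0<μ 0≤disc =
        let D , 0≤D , D²≈ = squareRoot 0≤disc
            0<S = +-nonneg-pos 0≤D (+-pos 0<lam 0<μ)
            w , 0<w , Sw≈1 = pos-inverse 0<S
            h , 0<h , 2h≈1 = pos-inverse 0<2
            0<b = *-pos (*-pos 0<lam 0<μ) 0<w
        in  _
          , paw∈𝒮ᴸ (*-pos 0<S (*-pos 0<h 0<h)) 0<b 0<b
              (*-pos (*-pos (+-nonneg-pos 0≤D 0<lam) 0<lam) (*-pos 0<w 0<h))
          , spectrum₀ 0<S refl D²≈ Sw≈1 2h≈1

      -- The sign of the discriminant and the thresholds (2 ± √3) lam.

      √3²≈3 : √3 * √3 ≈ 3#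
      √3²≈3 = proj₂ (proj₂ (squareRoot (<-asym 0<3)))

      -- A square root comes only with nonnegativity. Cotransitivity offers √3 < 1 as the
      -- alternative, and squaring that would give 3 < 1.
      0<√3 : 0# < √3
      0<√3 = [ id , (λ √3<1 → contradiction (√3<1⇒3<1 √3<1) (<-asym 1<3)) ]′
        (<-cotrans 0<1 √3)
        where
        1<3 : 1# < 3#
        1<3 = x+d 0<2 (solve 0 (con 1ℤ :+ con (+ 2) := con (+ 3)) refl)

        √3<1⇒3<1 : √3 < 1# → 3# < 1#
        √3<1⇒3<1 √3<1 = <-respˡ-≈ √3²≈3 (<-respʳ-≈ (*-identityˡ 1#)
          (square-mono⁺ (proj₁ (proj₂ (squareRoot (<-asym 0<3)))) √3<1))

      -- The roots of `discriminant` as a quadratic in `μ`.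
      lower upper : Carrier
      lower = (2# - √3) * lam
      upper = (2# + √3) * lam

      lower<upper : lower < upper
      lower<upper = x+d (*-pos (+-pos 0<√3 0<√3) 0<lam)
        (solve 2 (λ r l → (con (+ 2) :- r) :* l :+ (r :+ r) :* l := (con (+ 2) :+ r) :* l)
          refl √3 lam)

      [upper-μ][lower-μ]≈ : (upper - μ) * (lower - μ) ≈ discriminant
      [upper-μ][lower-μ]≈ = begin
        (upper - μ) * (lower - μ)
          ≈⟨ solve 3 (λ r l m →
               ((con (+ 2) :+ r) :* l :- m) :* ((con (+ 2) :- r) :* l :- m) :=
               l :* l :+ m :* m :- con (+ 4) :* (l :* m) :+ (con (+ 3) :- r :* r) :* (l :* l))
               refl √3 lam μ ⟩
        discriminant + (3# - √3 * √3) * (lam * lam)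
          ≈⟨ +-congˡ (*-congʳ (x≈y⇒x∙y⁻¹≈ε (sym √3²≈3))) ⟩
        discriminant + 0# * (lam * lam)
          ≈⟨ trans (+-congˡ (zeroˡ _)) (+-identityʳ _) ⟩
        discriminant ∎

      between⇒discriminant<0 : lower < μ → μ < upper → discriminant < 0#
      between⇒discriminant<0 lower<μ μ<upper = <-respˡ-≈ (begin
        - ((upper - μ) * (μ - lower))
          ≈⟨ solve 3 (λ u l m → :- ((u :- m) :* (m :- l)) := (u :- m) :* (l :- m)) refl upper lower μ ⟩
        (upper - μ) * (lower - μ)
          ≈⟨ [upper-μ][lower-μ]≈ ⟩
        discriminant ∎)
        (neg-neg (*-pos (x<y⇒0<y-x μ<upper) (x<y⇒0<y-x lower<μ)))

      -- The factor at the nearer threshold is only nonnegative; `lower<upper` makes the other one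
      -- strictly positive, as `*-nonneg-pos` requires.
      outside⇒discriminant≥0 : upper ≤ μ ⊎ μ ≤ lower → 0# ≤ discriminant
      outside⇒discriminant≥0 (inj₁ upper≤μ) = ≤-respʳ-≈
        (trans (solve 3 (λ u l m → (m :- u) :* (m :- l) := (u :- m) :* (l :- m)) refl upper lower μ)
          [upper-μ][lower-μ]≈)
        (*-nonneg-pos (x≤y⇒0≤y-x upper≤μ) (x<y⇒0<y-x (<-≤-trans lower<upper upper≤μ)))
      outside⇒discriminant≥0 (inj₂ μ≤lower) = ≤-respʳ-≈
        (trans (*-comm _ _) [upper-μ][lower-μ]≈)
        (*-nonneg-pos (x≤y⇒0≤y-x μ≤lower) (x<y⇒0<y-x (≤-<-trans μ≤lower lower<upper)))

      -- Because the thresholds are strictly ordered, cotransitivity at `μ` selects the disjunct.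
      -- Its inequality is a negation, refuted by the negative discriminant between the thresholds.
      discriminant≥0⇒outside : 0# ≤ discriminant → upper ≤ μ ⊎ μ ≤ lower
      discriminant≥0⇒outside 0≤disc =
        [ (λ lower<μ → inj₁ λ μ<upper → 0≤disc (between⇒discriminant<0 lower<μ μ<upper))
        , (λ μ<upper → inj₂ λ lower<μ → 0≤disc (between⇒discriminant<0 lower<μ μ<upper))
        ]′ (<-cotrans lower<upper μ)

      0<upper : 0# < upper
      0<upper = *-pos (+-pos 0<2 0<√3) 0<lam

theorem3p13 : ∀ {c ℓ} (ℝ : Reals c ℓ) →
    let open Reals ℝ
        open SquareRoot ℝ using (√3)
        open Laplacian ℝ using (LaplacianRealizable)
    in
    ∀ (lam μ : Carrier) → 0# < lam →
    LaplacianRealizable Paw (0# ∷ lam ∷ lam ∷ μ ∷ []) ⇔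
    ((2# + √3) * lam ≤ μ ⊎ (0# < μ × μ ≤ (2# - √3) * lam))
theorem3p13 ℝ lam μ 0<lam = mk⇔
  (λ realizable →
    let 0<μ , 0≤disc = realizable⇒discriminant≥0 0<lam realizable
    in  Sum.map₂ (0<μ ,_) (discriminant≥0⇒outside 0<lam 0≤disc))
  -- The first alternative does not state that `μ` is positive; this follows from 0 < `upper` ≤ `μ`.
  [ (λ upper≤μ → discriminant≥0⇒realizable 0<lam (<-≤-trans (0<upper {μ = μ} 0<lam) upper≤μ)
      (outside⇒discriminant≥0 0<lam (inj₁ upper≤μ)))
  , (λ (0<μ , μ≤lower) → discriminant≥0⇒realizable 0<lam 0<μ
      (outside⇒discriminant≥0 0<lam (inj₂ μ≤lower)))
  ]′
  where
  open SquareRoot ℝ using (<-≤-trans)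
  open PawSpectrum ℝ
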